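{- Let $\mathcal{A}_1$ and $\mathcal{A}_2$ be two decidable classes of sequence automata. Then the class $\mathcal{A}_1(\mathcal{A}_2)$ of temporalized automata is decidable.
   Context: A class of automata is decidable if its emptiness problem is decidable: there is an algorithm that, given $A$ in the class, decides whether $\mathcal{L}(A)=\emptyset$. For a finite alphabet $\Sigma$, $\mathcal{S}(\Sigma)$ is the set of $\Sigma$-labeled infinite sequences $(\mathbb{N},<,V)$ with $V:\mathbb{N}\to\Sigma$. Sequence automata. A sequence automaton over $\Sigma$ consists of a labeled transition system $(Q,q_0,\Delta,M,\Omega)$, with $Q$ a finite set of states, $q_0\in Q$ initial, $\Delta\subseteq Q\times\Sigma\times Q$, $\Omega$ a finite alphabet, $M\subseteq Q\times\Omega$ a labeling of states, together with an acceptance condition $AC$ on functions $\sigma:\mathbb{N}\to Q$. A run on $(\mathbb{N},<,V)$ is a function $\sigma:\mathbb{N}\to Q$ with $\sigma(0)=q_0$ and $(\sigma(i),V(i),\sigma(i+1))\in\Delta$ for all $i\ge 0$. The sequence is accepted iff some run $\sigma$ on it satisfies $AC(\sigma)$; $\mathcal{L}(A)\subseteq\mathcal{S}(\Sigma)$ is the set of accepted sequences. A class of sequence automata is a set of automata sharing the acceptance condition $AC$: it consists of the labeled transition systems (over any finite input alphabet, with the kind of state labeling $AC$ refers to) equipped with $AC$, where $AC$ may refer to $Q,q_0,M,\Omega$ but not to $\Delta$ or to the input alphabet. (Example: Büchi automata, $\Omega=\{\mathtt{final}\}$, $AC(\sigma)$: some $q$ with $(q,\mathtt{final})\in M$ occurs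 infinitely often in $\sigma$.) Temporalized automata. $\mathcal{S}(\mathcal{S}(\Sigma))$ is the set of $(\mathbb{N},<,g)$ with $g:\mathbb{N}\to\mathcal{S}(\Sigma)$. Let $\Gamma(\Sigma)$ be a finite alphabet whose symbols are automata of $\mathcal{A}_2$ over $\Sigma$. A temporalized automaton in $\mathcal{A}_1(\mathcal{A}_2)$ over $\Gamma(\Sigma)$ is a labeled transition system $(Q,q_0,\Delta,M,\Omega)$, with $Q$ a finite set of states, $q_0\in Q$ initial, $\Delta\subseteq Q\times\Gamma(\Sigma)\times Q$, $\Omega$ a finite alphabet, and $M\subseteq Q\times\Omega$ a labeling of states (of the kind the acceptance condition of $\mathcal{A}_1$ refers to). A run on $(\mathbb{N},<,g)$ is a function $\sigma:\mathbb{N}\to Q$ with $\sigma(0)=q_0$ such that for every $i\ge0$ there is $B\in\Gamma(\Sigma)$ with $(\sigma(i),B,\sigma(i+1))\in\Delta$ and $g(i)\in\mathcal{L}(B)$. It accepts $(\mathbb{N},<,g)$ iff some run $\sigma$ satisfies the acceptance condition $AC(\sigma)$ of $\mathcal{A}_1$; $\mathcal{L}(A)$ is the set of accepted elements of $\mathcal{S}(\mathcal{S}(\Sigma))$. -}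

module Defs where

open import Data.Bool using (Bool; T)
open import Data.Fin using (Fin)
open import Data.Nat using (ℕ; zero; suc)
open import Data.Product using (_×_; ∃-syntax)
open import Function.Bundles using (_↔_)
open import Level using (0ℓ)
open import Relation.Binary.PropositionalEquality using (_≡_)
open import Relation.Nullary using (Dec)
open import Relation.Unary using (Pred; Empty; _∈_)

record FiniteSet : Set₁ where
  field
    Carrier     : Set
    size        : ℕ
    enumeration : Carrier ↔ Fin size

open FiniteSet public using () renaming (Carrier to ∣_∣)

-- Subsets of finite sets that are part of an automaton (the transitions Δ and
-- the labeling M) are finite data handed to an algorithm, so they are given by
-- Boolean characteristic functions.

-- The part of a labeled transition system an acceptance condition may refer
-- to: (Q, q₀, M, Ω), without Δ and without the input alphabet.
record LabeledStates : Set₁ where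
  field
    Q  : FiniteSet
    q₀ : ∣ Q ∣
    Ω  : FiniteSet
    M  : ∣ Q ∣ → ∣ Ω ∣ → Bool

record LTS (Alphabet : FiniteSet) : Set₁ where
  field
    states : LabeledStates
  open LabeledStates states public
  field
    Δ : ∣ Q ∣ → ∣ Alphabet ∣ → ∣ Q ∣ → Bool

-- A class of sequence automata is determined by its acceptance condition AC
-- and by the kind of state labelings that AC refers to; for instance, Büchi
-- automata are those whose Ω has the single element `final`.
record AutomataClass : Set₁ where
  field
    Kind : (Q Ω : FiniteSet) → (∣ Q ∣ → ∣ Ω ∣ → Bool) → Set
    AC   : (S : LabeledStates) → Pred (ℕ → ∣ LabeledStates.Q S ∣) 0ℓ

-- Transition systems over an alphabet with the labeling required by the class.
-- Both sequence automata and temporalized automata are of this form.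
record LTSOf (𝒜 : AutomataClass) (Alphabet : FiniteSet) : Set₁ where
  field
    lts : LTS Alphabet
  open LTS lts public
  field
    ofKind : AutomataClass.Kind 𝒜 Q Ω M

  Accepting : Pred (ℕ → ∣ Q ∣) 0ℓ
  Accepting = AutomataClass.AC 𝒜 states

-- The sequence (ℕ, <, V) is represented by V.
𝒮 : Set → Set
𝒮 X = ℕ → X

SequenceAutomaton : AutomataClass → FiniteSet → Set₁
SequenceAutomaton = LTSOf

module _ {𝒜 : AutomataClass} {Alphabet : FiniteSet}
         (A : SequenceAutomaton 𝒜 Alphabet) where
  open LTSOf A

  Run : 𝒮 ∣ Alphabet ∣ → Pred (ℕ → ∣ Q ∣) 0ℓ
  Run V σ = σ zero ≡ q₀ × (∀ i → T (Δ (σ i) (V i) (σ (suc i))))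

  ℒ : Pred (𝒮 ∣ Alphabet ∣) 0ℓ
  ℒ V = ∃[ σ ] (Run V σ × σ ∈ Accepting)

-- A constructive function returning a decision plays the role of the algorithm.
DecidableClass : AutomataClass → Set₁
DecidableClass 𝒜 = ∀ (Alphabet : FiniteSet) (A : SequenceAutomaton 𝒜 Alphabet) →
  Dec (Empty (ℒ A))

-- Γ(Σ): a finite set of symbols, each of which stands for an automaton of 𝒜₂
-- over the same alphabet.
record AutomataAlphabet (𝒜₂ : AutomataClass) (Alphabet : FiniteSet) : Set₁ where
  field
    symbols   : FiniteSet
    automaton : ∣ symbols ∣ → SequenceAutomaton 𝒜₂ Alphabet

TemporalizedAutomaton : (𝒜₁ : AutomataClass) {𝒜₂ : AutomataClass}
  {Alphabet : FiniteSet} →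
  AutomataAlphabet 𝒜₂ Alphabet → Set₁
TemporalizedAutomaton 𝒜₁ Γ = LTSOf 𝒜₁ (AutomataAlphabet.symbols Γ)

module _ {𝒜₁ 𝒜₂ : AutomataClass} {Alphabet : FiniteSet}
         (Γ : AutomataAlphabet 𝒜₂ Alphabet)
         (A : TemporalizedAutomaton 𝒜₁ Γ) where
  open AutomataAlphabet Γ
  open LTSOf A

  TemporalizedRun : 𝒮 (𝒮 ∣ Alphabet ∣) → Pred (ℕ → ∣ Q ∣) 0ℓ
  TemporalizedRun g σ = σ zero ≡ q₀ ×
    (∀ i → ∃[ B ] (T (Δ (σ i) B (σ (suc i))) × g i ∈ ℒ (automaton B)))

  temporalizedℒ : Pred (𝒮 (𝒮 ∣ Alphabet ∣)) 0ℓ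
  temporalizedℒ g = ∃[ σ ] (TemporalizedRun g σ × σ ∈ Accepting)

TemporalizedDecidable : AutomataClass → AutomataClass → Set₁
TemporalizedDecidable 𝒜₁ 𝒜₂ =
  ∀ (Alphabet : FiniteSet) (Γ : AutomataAlphabet 𝒜₂ Alphabet)
    (A : TemporalizedAutomaton 𝒜₁ Γ) →
  Dec (Empty (temporalizedℒ Γ A))

{-# OPTIONS --safe #-}
-- Delete from the temporalized automaton every transition whose symbol names an
-- automaton with empty language, and read the symbols as letters: the resulting
-- sequence automaton of 𝒜₁ has empty language iff the temporalized one does.
-- One direction chooses a witness in the language of each nonempty symbol.
-- Emptiness is a negative statement and the symbols are finite in number, so
-- the double negations of these choices can be exchanged with the
-- quantification over symbols, and no choice principle is required.
module Submission where

open import Data.Bool using (_∧_; T)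
open import Data.Bool.Properties using (T-∧)
open import Data.Fin.Properties using (sequence)
open import Data.Nat using (suc)
open import Data.Product using (_×_; _,_; curry; map₂; proj₁; proj₂)
open import Effect.Monad using (RawMonad)
open import Function.Base using (_∘_)
open import Function.Bundles using (_⇔_; mk⇔; module Equivalence; module Inverse)
open import Relation.Binary.PropositionalEquality using (subst)
open import Relation.Nullary using (¬_; Dec; yes; no; contradiction)
open import Relation.Nullary.Decidable
  using (isNo; fromWitnessFalse; toWitnessFalse; map′; ¬¬-excluded-middle)
open import Relation.Nullary.Negation using (¬¬-Monad)
open import Relation.Unary using (Pred; Empty; Satisfiable)

open import Defs

-- Applicative effects commute with finite products, and `¬ ¬_` is one. Over ℕ this would be
-- double-negation shift.
¬¬-choice : (X : FiniteSet) {P : ∣ X ∣ → Set} →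
  (∀ x → ¬ ¬ P x) → ¬ ¬ (∀ x → P x)
¬¬-choice X {P} ¬¬p ¬∀p =
  sequence (RawMonad.rawApplicative ¬¬-Monad) (¬¬p ∘ from) λ p →
    ¬∀p λ x → subst P (strictlyInverseʳ x) (p (to x))
  where open Inverse (FiniteSet.enumeration X)

¬Empty⇒Satisfiable : ∀ {a ℓ} {A : Set a} {P : Pred A ℓ} →
  Dec (Satisfiable P) → ¬ Empty P → Satisfiable P
¬Empty⇒Satisfiable (yes ∃p) _  = ∃p
¬Empty⇒Satisfiable (no ¬∃p) ¬∅ = contradiction (curry ¬∃p) ¬∅

module _ {𝒜₁ 𝒜₂ : AutomataClass} {Alphabet : FiniteSet}
         (Γ : AutomataAlphabet 𝒜₂ Alphabet)
         (A : TemporalizedAutomaton 𝒜₁ Γ)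
         (empty? : ∀ B → Dec (Empty (ℒ (AutomataAlphabet.automaton Γ B)))) where
  open AutomataAlphabet Γ
  open LTSOf A

  -- Keeping `states` intact makes `ofKind` and acceptance of a given `σ` carry over verbatim.
  prune : SequenceAutomaton 𝒜₁ symbols
  prune = record
    { lts    = record
      { states = states
      ; Δ      = λ q B q′ → Δ q B q′ ∧ isNo (empty? B)
      }
    ; ofKind = ofKind
    }

  prune-edge : ∀ {q B q′} →
    T (LTSOf.Δ prune q B q′) ⇔ (T (Δ q B q′) × ¬ Empty (ℒ (automaton B)))
  prune-edge {q} {B} {q′} = mk⇔
    (map₂ (toWitnessFalse {a? = empty? B}) ∘ Equivalence.to (T-∧ {Δ q B q′}))
    (Equivalence.from T-∧ ∘ map₂ fromWitnessFalse)

  prune-empty⇒empty : Empty (ℒ prune) → Empty (temporalizedℒ Γ A)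
  prune-empty⇒empty ∅ g (σ , (σ₀ , step) , acc) =
    -- The input word lists the symbols used along the run; `g i` shows that the `i`-th survives
    -- pruning.
    ∅ (proj₁ ∘ step) (σ , (σ₀ , λ i →
      let B , δ , gᵢ∈B = step i in
      Equivalence.from prune-edge (δ , λ B∅ → B∅ (g i) gᵢ∈B)) , acc)

  empty⇒prune-empty : Empty (temporalizedℒ Γ A) → Empty (ℒ prune)
  empty⇒prune-empty ∅ V (σ , (σ₀ , step) , acc) =
    ¬¬-choice symbols {λ B → Dec (Satisfiable (ℒ (automaton B)))}
      (λ _ → ¬¬-excluded-middle) λ satisfiable? →
      let w : ∀ i → Satisfiable (ℒ (automaton (V i)))
          w i = ¬Empty⇒Satisfiable (satisfiable? (V i)) (proj₂ (edge i))
      in ∅ (proj₁ ∘ w) (σ , (σ₀ , λ i → V i , proj₁ (edge i) , proj₂ (w i)) , acc)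
    where
    edge : ∀ i → T (Δ (σ i) (V i) (σ (suc i))) × ¬ Empty (ℒ (automaton (V i)))
    edge i = Equivalence.to prune-edge (step i)

theorem2p8 : (𝒜₁ 𝒜₂ : AutomataClass) →
    DecidableClass 𝒜₁ → DecidableClass 𝒜₂ → TemporalizedDecidable 𝒜₁ 𝒜₂
theorem2p8 𝒜₁ 𝒜₂ dec₁ dec₂ Alphabet Γ A =
  map′ (prune-empty⇒empty Γ A empty?) (empty⇒prune-empty Γ A empty?)
    (dec₁ symbols (prune Γ A empty?))
  where
  open AutomataAlphabet Γ

  empty? : ∀ B → Dec (Empty (ℒ (automaton B)))
  empty? B = dec₂ Alphabet (automaton B)
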